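{- Let $n\ge 1$ and $k$ be integers with $\lfloor n/2\rfloor \le k\le \lfloor (2n-2)/3\rfloor$. Then the diameter of $\Phi^n_k$ is $$\operatorname{diam}(\Phi^n_k)=(2n-3k-2)(2k-n+1).$$
   Context: A subword of a word is a block of consecutive letters. A binary word (over $\{0,1\}$) of length $n\ge 1$ is Padovan if it starts and ends with $0$, contains no subword $00$, and contains no subword $111$. For $n\ge1$ and $\lfloor n/2\rfloor\le k\le\lfloor(2n-2)/3\rfloor$, the weighted Padovan graph $\Phi^n_k$ is the simple graph whose vertices are all Padovan words of length $n$ with exactly $k$ letters $1$; two vertices are adjacent if one can be obtained from the other by replacing exactly one subword $01$ with $10$. -}

module Defs where

open import Data.Fin using (Fin; _≟_)
open import Data.Fin.Patterns using (0F; 1F)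
open import Data.List using (List; []; _∷_; _++_; length; filter; head; last)
open import Data.List.Properties using (++-cancelˡ)
open import Data.List.Relation.Binary.Infix.Heterogeneous using (Infix)
open import Data.Maybe using (just)
open import Data.Nat using (ℕ; zero; suc; _≤_)
open import Data.Product using (∃; ∃-syntax; _×_; _,_)
open import Data.Sum using (_⊎_; inj₁; inj₂; swap)
open import Level using (0ℓ)
open import Relation.Binary using (Rel; Setoid; Symmetric; Irreflexive; _Respects₂_)
import Relation.Binary.Construct.On as On
open import Relation.Binary.PropositionalEquality
  using (_≡_; refl; sym; trans; setoid)
open import Relation.Nullary using (¬_)

-- Vertices form a setoid, so that a vertex may carry proofs that play no
-- role in its identity.
record SimpleGraph : Set₁ where
  field
    vertices : Setoid 0ℓ 0ℓ
  open Setoid vertices public using (_≈_) renaming (Carrier to Vertex)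
  field
    _~_      : Rel Vertex 0ℓ
    ~-sym    : Symmetric _~_
    ~-irrefl : Irreflexive _≈_ _~_
    ~-resp-≈ : _~_ Respects₂ _≈_

module _ (G : SimpleGraph) where
  open SimpleGraph G

  data Walk : Vertex → Vertex → ℕ → Set where
    nil  : ∀ {u v} → u ≈ v → Walk u v zero
    cons : ∀ {u v w m} → u ~ v → Walk v w m → Walk u w (suc m)

  IsDistance : Vertex → Vertex → ℕ → Set
  IsDistance u v d = Walk u v d × (∀ m → Walk u v m → d ≤ m)

  -- The maximum of all distances. In particular the graph is non-empty and
  -- any two vertices are joined by a walk.
  IsDiameter : ℕ → Set
  IsDiameter D =
      (∀ u v → ∃[ d ] (IsDistance u v d × d ≤ D))
    × (∃[ u ] ∃[ v ] IsDistance u v D)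

Word : Set
Word = List (Fin 2)

_isSubwordOf_ : Word → Word → Set
_isSubwordOf_ = Infix _≡_

record IsPadovan (w : Word) : Set where
  field
    starts-with-0 : head w ≡ just 0F
    ends-with-0   : last w ≡ just 0F
    no-00         : ¬ ((0F ∷ 0F ∷ []) isSubwordOf w)
    no-111        : ¬ ((1F ∷ 1F ∷ 1F ∷ []) isSubwordOf w)

#1s : Word → ℕ
#1s w = length (filter (_≟ 1F) w)

-- v arises from u by replacing one occurrence of the subword 01 with 10.
_⟶_ : Word → Word → Set
u ⟶ v = ∃[ p ] ∃[ s ] (u ≡ p ++ (0F ∷ 1F ∷ []) ++ s
                      × v ≡ p ++ (1F ∷ 0F ∷ []) ++ s)

⟶-irrefl : Irreflexive _≡_ _⟶_
⟶-irrefl u≡v (p , s , u≡ , v≡)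
  with ++-cancelˡ p _ _ (trans (sym u≡) (trans u≡v v≡))
... | ()

Adjacent : Word → Word → Set
Adjacent u v = (u ⟶ v) ⊎ (v ⟶ u)

Adjacent-irrefl : Irreflexive _≡_ Adjacent
Adjacent-irrefl u≡v (inj₁ u⟶v) = ⟶-irrefl u≡v u⟶v
Adjacent-irrefl u≡v (inj₂ v⟶u) = ⟶-irrefl (sym u≡v) v⟶u

record PadovanWord (n k : ℕ) : Set where
  field
    word      : Word
    isPadovan : IsPadovan word
    length≡n  : length word ≡ n
    #1s≡k     : #1s word ≡ k

open PadovanWord

Φ : ℕ → ℕ → SimpleGraph
Φ n k = record
  { vertices = On.setoid {B = PadovanWord n k} (setoid Word) word
  ; _~_      = λ u v → Adjacent (word u) (word v)
  ; ~-sym    = swap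
  ; ~-irrefl = Adjacent-irrefl
  ; ~-resp-≈ = (λ { refl a → a }) , (λ { refl a → a })
  }

{-# OPTIONS --safe #-}
-- Behind its initial 0, a Padovan word is a sequence of blocks 10 ("short")
-- and 110 ("long"), and an edge exchanges two adjacent blocks of different
-- kinds. The distance of two block sequences is therefore the ℓ¹-distance of
-- their functions counting the long blocks in each prefix: an exchange changes
-- that sum by one, and moving the first long block to the front, when the
-- target starts with a long block, lowers it at every step. With a short and b
-- long blocks such a move takes at most a steps and leaves b − 1 long blocks,
-- so distances are at most a b, attained between short^a long^b and
-- long^b short^a. Finally a = 2n − 3k − 2 and b = 2k − n + 1.
module Submission where

open import Defs
open import Data.Nat using (ℕ; _≤_; _∸_; _/_) renaming (_*_ to _*ℕ_)
open import Data.Integer using (ℤ; +_; _+_; _-_; _*_)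
open import Data.Product using (∃-syntax; _×_)
open import Relation.Binary.PropositionalEquality using (_≡_)

open import Data.Empty using (⊥-elim)
open import Data.Fin.Patterns using (0F; 1F)
open import Data.Integer.Properties using (pos-+; pos-*)
import Data.Integer.Tactic.RingSolver as ℤ-Solver
open import Data.List using ([]; _∷_; _++_; length; last)
open import Data.List.Relation.Binary.Infix.Heterogeneous using (here; there)
open import Data.List.Relation.Binary.Prefix.Heterogeneous using ([]; _∷_)
open import Data.Maybe using (just)
open import Data.Nat using (zero; suc; _<_; ∣_-_∣; s≤s; z≤n) renaming (_+_ to _+ℕ_)
open import Data.Nat.DivMod using (m≡m%n+[m/n]*n; m%n<n; m/n*n≤m)
open import Data.Nat.Properties
import Data.Nat.Tactic.RingSolver as ℕ-Solver
open import Data.Product using (_,_; proj₁; proj₂)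
open import Data.Sum using (_⊎_; inj₁; inj₂; swap)
open import Data.Vec using (Vec; []; _∷_)
open import Relation.Binary.PropositionalEquality
  using (refl; sym; trans; cong; cong₂; subst; subst₂; module ≡-Reasoning)
open import Relation.Nullary using (¬_)

-- Block sequences and exchanges of adjacent blocks.

data Block : Set where
  short long : Block

private variable
  m i j p q : ℕ
  x y z : Vec Block m
  w w′ : Word

shorts longs : Vec Block m → ℕ
shorts []          = 0
shorts (short ∷ x) = suc (shorts x)
shorts (long ∷ x)  = shorts x
longs []          = 0
longs (short ∷ x) = longs x
longs (long ∷ x)  = suc (longs x)

_≈ₘ_ : Vec Block m → Vec Block m → Set
x ≈ₘ y = shorts x ≡ shorts y × longs x ≡ longs y

shorts+longs : (x : Vec Block m) → shorts x +ℕ longs x ≡ m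
shorts+longs []          = refl
shorts+longs (short ∷ x) = cong suc (shorts+longs x)
shorts+longs (long ∷ x)  = trans (+-suc _ _) (cong suc (shorts+longs x))

data _↝_ : Vec Block m → Vec Block m → Set where
  here  : (short ∷ long ∷ x) ↝ (long ∷ short ∷ x)
  there : ∀ c → x ↝ y → (c ∷ x) ↝ (c ∷ y)

_↭_ : Vec Block m → Vec Block m → Set
x ↭ y = (x ↝ y) ⊎ (y ↝ x)

↝⇒≈ₘ : x ↝ y → x ≈ₘ y
↝⇒≈ₘ here            = refl , refl
↝⇒≈ₘ (there short s) = let e , f = ↝⇒≈ₘ s in cong suc e , f
↝⇒≈ₘ (there long s)  = let e , f = ↝⇒≈ₘ s in e , cong suc f

↭⇒≈ₘ : x ↭ y → x ≈ₘ y
↭⇒≈ₘ (inj₁ s) = ↝⇒≈ₘ s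
↭⇒≈ₘ (inj₂ s) = let e , f = ↝⇒≈ₘ s in sym e , sym f

data Path {m} : Vec Block m → Vec Block m → ℕ → Set where
  nil  : Path x x 0
  cons : x ↭ y → Path y z i → Path x z (suc i)

_++ᵖ_ : Path x y i → Path y z j → Path x z (i +ℕ j)
nil      ++ᵖ Q = Q
cons s P ++ᵖ Q = cons s (P ++ᵖ Q)

snoc : Path x y i → y ↭ z → Path x z (suc i)
snoc nil        t = cons t nil
snoc (cons s P) t = cons s (snoc P t)

reverse : Path x y i → Path y x i
reverse nil        = nil
reverse (cons s P) = snoc (reverse P) (swap s)

prepend : ∀ c → Path x y i → Path (c ∷ x) (c ∷ y) i
prepend c nil               = nil
prepend c (cons (inj₁ s) P) = cons (inj₁ (there c s)) (prepend c P)
prepend c (cons (inj₂ s) P) = cons (inj₂ (there c s)) (prepend c P)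

-- Distance of prefix counts and its change under moves of blocks.

advance : Block → ℕ → ℕ
advance short p = p
advance long  p = suc p

-- p and q count the long blocks already passed on either side.
dist : ℕ → ℕ → Vec Block m → Vec Block m → ℕ
dist p q []      []      = 0
dist p q (c ∷ x) (d ∷ y) =
  ∣ advance c p - advance d q ∣ +ℕ dist (advance c p) (advance d q) x y

dist-refl : ∀ p (x : Vec Block m) → dist p p x x ≡ 0
dist-refl p []      = refl
dist-refl p (c ∷ x) = cong₂ _+ℕ_ (∣n-n∣≡0 (advance c p)) (dist-refl (advance c p) x)

dist-sym : ∀ p q (x y : Vec Block m) → dist p q x y ≡ dist q p y x
dist-sym p q []      []      = refl
dist-sym p q (c ∷ x) (d ∷ y) =
  cong₂ _+ℕ_ (∣-∣-comm (advance c p) (advance d q)) (dist-sym (advance c p) (advance d q) x y)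

-- Only differences of counts enter, so a long block passed on both sides can be forgotten.
dist-suc : ∀ p q (x y : Vec Block m) → dist (suc p) (suc q) x y ≡ dist p q x y
dist-suc p q []          []          = refl
dist-suc p q (short ∷ x) (short ∷ y) = cong (∣ p - q ∣ +ℕ_) (dist-suc p q x y)
dist-suc p q (short ∷ x) (long ∷ y)  = cong (∣ p - suc q ∣ +ℕ_) (dist-suc p (suc q) x y)
dist-suc p q (long ∷ x)  (short ∷ y) = cong (∣ suc p - q ∣ +ℕ_) (dist-suc (suc p) q x y)
dist-suc p q (long ∷ x)  (long ∷ y)  = cong (∣ p - q ∣ +ℕ_) (dist-suc (suc p) (suc q) x y)

∣m-n∣≤1+∣1+m-n∣ : ∀ m n → ∣ m - n ∣ ≤ suc ∣ suc m - n ∣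
∣m-n∣≤1+∣1+m-n∣ zero    zero    = z≤n
∣m-n∣≤1+∣1+m-n∣ zero    (suc n) = ≤-refl
∣m-n∣≤1+∣1+m-n∣ (suc m) zero    = ≤-trans (n≤1+n _) (n≤1+n _)
∣m-n∣≤1+∣1+m-n∣ (suc m) (suc n) = ∣m-n∣≤1+∣1+m-n∣ m n

∣1+m-n∣≤1+∣m-n∣ : ∀ m n → ∣ suc m - n ∣ ≤ suc ∣ m - n ∣
∣1+m-n∣≤1+∣m-n∣ zero    zero    = ≤-refl
∣1+m-n∣≤1+∣m-n∣ zero    (suc n) = ≤-trans (n≤1+n _) (n≤1+n _)
∣1+m-n∣≤1+∣m-n∣ (suc m) zero    = ≤-refl
∣1+m-n∣≤1+∣m-n∣ (suc m) (suc n) = ∣1+m-n∣≤1+∣m-n∣ m n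

m<n⇒∣m-n∣≡1+∣1+m-n∣ : p < q → ∣ p - q ∣ ≡ suc ∣ suc p - q ∣
m<n⇒∣m-n∣≡1+∣1+m-n∣ {zero}  (s≤s _) = refl
m<n⇒∣m-n∣≡1+∣1+m-n∣ {suc p} (s≤s r) = m<n⇒∣m-n∣≡1+∣1+m-n∣ r

-- At the exchanged pair only the prefix ending between the two blocks changes its count, by one;
-- after both blocks the counts agree again. Hence a single summand moves, by at most one.
dist-↝ : ∀ p q → x ↝ y → (v : Vec Block m) →
         dist p q x v ≤ suc (dist p q y v) × dist p q y v ≤ suc (dist p q x v)
dist-↝ p q here (c ∷ d ∷ v) =
    +-monoˡ-≤ _ (∣m-n∣≤1+∣1+m-n∣ p (advance c q))
  , +-monoˡ-≤ _ (∣1+m-n∣≤1+∣m-n∣ p (advance c q))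
dist-↝ p q (there c s) (d ∷ v) =
  let p′ = advance c p
      q′ = advance d q
      l , r = dist-↝ p′ q′ s v
      e = ∣ p′ - q′ ∣
  in ≤-trans (+-monoʳ-≤ e l) (≤-reflexive (+-suc e _))
   , ≤-trans (+-monoʳ-≤ e r) (≤-reflexive (+-suc e _))

dist-↭ : x ↭ y → (v : Vec Block m) → dist 0 0 x v ≤ suc (dist 0 0 y v)
dist-↭ (inj₁ s) v = proj₁ (dist-↝ 0 0 s v)
dist-↭ (inj₂ s) v = proj₂ (dist-↝ 0 0 s v)

-- x starts with exactly i short blocks followed by a long one, and z is x
-- without that long block.
data Pull : ℕ → Vec Block (suc m) → Vec Block m → Set where
  stop : Pull 0 (long ∷ x) x
  skip : Pull i x z → Pull (suc i) (short ∷ x) (short ∷ z)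

pull : ∀ {b} (x : Vec Block (suc m)) → longs x ≡ suc b → ∃[ i ] ∃[ z ] Pull i x z
pull (long ∷ x)          _ = 0 , x , stop
pull (short ∷ [])        ()
pull (short ∷ x@(_ ∷ _)) e = let i , z , P = pull x e in suc i , short ∷ z , skip P

Pull-shorts : Pull i x z → shorts x ≡ shorts z
Pull-shorts stop     = refl
Pull-shorts (skip P) = cong suc (Pull-shorts P)

Pull-longs : Pull i x z → longs x ≡ suc (longs z)
Pull-longs stop     = refl
Pull-longs (skip P) = Pull-longs P

Pull-≤ : Pull i x z → i ≤ shorts x
Pull-≤ stop     = z≤n
Pull-≤ (skip P) = s≤s (Pull-≤ P)

-- One exchange for each short block in front. The tail is treated first, so the exchange with the
-- foremost short block comes last.
Pull-path : Pull i x z → Path x (long ∷ z) i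
Pull-path stop     = nil
Pull-path (skip P) = snoc (prepend short (Pull-path P)) (inj₁ here)

-- On the right stands `long ∷ short ∷ z` with its long block already read. As `p < q`, each of the
-- `i` prefixes before the long block of `x` is behind the target, so moving that block forward
-- gains exactly one there. Only short blocks are read on the left meanwhile, so the lead of `q`
-- persists.
Pull-dist-< : Pull i x z → p < q → ∀ y →
              dist p q x y ≡ i +ℕ dist (suc p) q (short ∷ z) y
Pull-dist-< stop r (c ∷ y) = refl
Pull-dist-< {p = p} {q} (skip {i = i} {x = x} {z = z} P) r (c ∷ y) = begin
  ∣ p - q′ ∣ +ℕ dist p q′ x y                   ≡⟨ cong₂ _+ℕ_ (m<n⇒∣m-n∣≡1+∣1+m-n∣ (r′ c)) (Pull-dist-< P (r′ c) y) ⟩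
  suc e +ℕ (i +ℕ dist (suc p) q′ (short ∷ z) y) ≡⟨ exchange e i _ ⟩
  suc i +ℕ (e +ℕ dist (suc p) q′ (short ∷ z) y) ∎
  where
  open ≡-Reasoning
  q′ e : ℕ
  q′ = advance c q
  e = ∣ suc p - q′ ∣
  exchange : ∀ e i d → suc e +ℕ (i +ℕ d) ≡ suc i +ℕ (e +ℕ d)
  exchange = ℕ-Solver.solve-∀
  r′ : ∀ c → p < advance c q
  r′ short = r
  r′ long  = m<n⇒m<1+n r

-- The leading long block of the target creates the strict lead 0 < 1 that `Pull-dist-<` needs, so
-- the `i` exchanges of the pull lower the distance by exactly `i`.
Pull-dist : Pull i x z → ∀ y → dist 0 0 x (long ∷ y) ≡ i +ℕ dist 0 0 z y
Pull-dist (stop {x = x}) y = dist-suc 0 0 x y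
Pull-dist (skip {i = i} {z = z} P) y = cong suc
  (trans (Pull-dist-< P (s≤s z≤n) y) (cong (i +ℕ_) (dist-suc 0 0 (short ∷ z) y)))

-- Shortest paths and the extremal pair.

Geodesic : Vec Block m → Vec Block m → Set
Geodesic x y = Path x y (dist 0 0 x y) × dist 0 0 x y ≤ shorts x *ℕ longs x

geodesic-swap : x ≈ₘ y → Geodesic x y → Geodesic y x
geodesic-swap {x = x} {y = y} (e , f) (P , B) =
    subst (Path y x) (dist-sym 0 0 x y) (reverse P)
  , subst₂ _≤_ (dist-sym 0 0 x y) (cong₂ _*ℕ_ e f) B

-- Pull the first long block of `x` to the front, then continue behind it with `rec`. No step is
-- wasted by `Pull-dist`. The bound adds up as a + a (b - 1) = a b. Taking `rec` as an argument lets
-- both orientations in `geodesic` share this step.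
geodesic-long : (∀ (x y : Vec Block m) → x ≈ₘ y → Geodesic x y) →
                ∀ x (y : Vec Block m) → x ≈ₘ (long ∷ y) → Geodesic x (long ∷ y)
geodesic-long rec x y (e , f) =
  let i , z , P = pull x f
      W , B = rec z y (trans (sym (Pull-shorts P)) e , suc-injective (trans (sym (Pull-longs P)) f))
      open ≤-Reasoning
  in subst (Path x (long ∷ y)) (sym (Pull-dist P y)) (Pull-path P ++ᵖ prepend long W)
   , (begin
       dist 0 0 x (long ∷ y)              ≡⟨ Pull-dist P y ⟩
       i +ℕ dist 0 0 z y                  ≤⟨ +-mono-≤ (Pull-≤ P) B ⟩
       shorts x +ℕ shorts z *ℕ longs z    ≡⟨ cong (λ s → shorts x +ℕ s *ℕ longs z) (sym (Pull-shorts P)) ⟩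
       shorts x +ℕ shorts x *ℕ longs z    ≡⟨ sym (*-suc (shorts x) (longs z)) ⟩
       shorts x *ℕ suc (longs z)          ≡⟨ cong (shorts x *ℕ_) (sym (Pull-longs P)) ⟩
       shorts x *ℕ longs x                ∎)

geodesic : (x y : Vec Block m) → x ≈ₘ y → Geodesic x y
geodesic []          []          _       = nil , z≤n
geodesic (short ∷ x) (short ∷ y) (e , f) =
  let P , B = geodesic x y (suc-injective e , f)
  in prepend short P , ≤-trans B (m≤n+m _ _)
-- The unapplied `geodesic` is taken at the length of `y`, so the recursion descends on the common
-- length.
geodesic x           (long ∷ y)  e       = geodesic-long geodesic x y e
-- Only the source starts with a long block, so the path is built backwards.
geodesic (long ∷ x)  (short ∷ y) (e , f) =
  geodesic-swap (sym e , sym f) (geodesic-long geodesic (short ∷ y) x (sym e , sym f))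

-- Carrying x⁺ = short^a long^(b+1) along with x = short^a long^b provides the
-- Pull that the next step of the recursion needs.
farthest : ∀ a b → ∃[ m ] ∃[ x ] ∃[ x⁺ ] ∃[ y ]
  (Pull {m} a x⁺ x × shorts x ≡ a × longs x ≡ b × x ≈ₘ y × dist 0 0 x y ≡ a *ℕ b)
farthest a (suc b) =
  let m , x , x⁺ , y , P , ea , eb , (e , f) , d = farthest a b
      x⁺⁺ , P⁺ = again P
      g = Pull-shorts P
      h = Pull-longs P
  in suc m , x⁺ , x⁺⁺ , long ∷ y , P⁺ , trans g ea , trans h (cong suc eb)
   , (trans g e , trans h (cong suc f))
   , trans (Pull-dist P y) (trans (cong (a +ℕ_) d) (sym (*-suc a b)))
  where
  again : Pull i x z → ∃[ x⁺ ] Pull i x⁺ x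
  again (stop {x = x}) = long ∷ long ∷ x , stop
  again (skip P) = let x⁺ , P⁺ = again P in short ∷ x⁺ , skip P⁺
farthest a zero =
  let m , x , x⁺ , P , ea , eb = only a
  in m , x , x⁺ , x , P , ea , eb , (refl , refl) , trans (dist-refl 0 x) (sym (*-zeroʳ a))
  where
  only : ∀ a → ∃[ m ] ∃[ x ] ∃[ x⁺ ] (Pull {m} a x⁺ x × shorts x ≡ a × longs x ≡ 0)
  only zero    = 0 , [] , long ∷ [] , stop , refl , refl
  only (suc a) = let m , x , x⁺ , P , ea , eb = only a
                 in suc m , short ∷ x , short ∷ x⁺ , skip P , cong suc ea , eb

-- Blocks and words

-- The initial 0 of the Padovan word is left out. Being a relation, this can be inverted by matching
-- from either side: the letters at the front fix the first block.
data Blocks : Vec Block m → Word → Set where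
  []    : Blocks [] []
  short : Blocks x w → Blocks (short ∷ x) (1F ∷ 0F ∷ w)
  long  : Blocks x w → Blocks (long ∷ x) (1F ∷ 1F ∷ 0F ∷ w)

encode : (x : Vec Block m) → ∃[ w ] Blocks x w
encode []          = [] , []
encode (short ∷ x) = let w , B = encode x in 1F ∷ 0F ∷ w , short B
encode (long ∷ x)  = let w , B = encode x in 1F ∷ 1F ∷ 0F ∷ w , long B

Blocks-word-unique : Blocks x w → Blocks x w′ → w ≡ w′
Blocks-word-unique []        []        = refl
Blocks-word-unique (short B) (short C) = cong (λ w → 1F ∷ 0F ∷ w) (Blocks-word-unique B C)
Blocks-word-unique (long B)  (long C)  = cong (λ w → 1F ∷ 1F ∷ 0F ∷ w) (Blocks-word-unique B C)

Blocks-unique : {x y : Vec Block m} → Blocks x w → Blocks y w → x ≡ y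
Blocks-unique []        []        = refl
Blocks-unique (short B) (short C) = cong (short ∷_) (Blocks-unique B C)
Blocks-unique (long B)  (long C)  = cong (long ∷_) (Blocks-unique B C)

Blocks-length : Blocks {m} x w → length w ≡ 2 *ℕ shorts x +ℕ 3 *ℕ longs x
Blocks-length []        = refl
Blocks-length {x = short ∷ x} (short B) =
  trans (cong (2 +ℕ_) (Blocks-length B)) (lemma (shorts x) (longs x))
  where
  lemma : ∀ a b → 2 +ℕ (2 *ℕ a +ℕ 3 *ℕ b) ≡ 2 *ℕ suc a +ℕ 3 *ℕ b
  lemma = ℕ-Solver.solve-∀
Blocks-length {x = long ∷ x} (long B)  =
  trans (cong (3 +ℕ_) (Blocks-length B)) (lemma (shorts x) (longs x))
  where
  lemma : ∀ a b → 3 +ℕ (2 *ℕ a +ℕ 3 *ℕ b) ≡ 2 *ℕ a +ℕ 3 *ℕ suc b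
  lemma = ℕ-Solver.solve-∀

Blocks-#1s : Blocks {m} x w → #1s w ≡ shorts x +ℕ 2 *ℕ longs x
Blocks-#1s []        = refl
Blocks-#1s (short B) = cong suc (Blocks-#1s B)
Blocks-#1s {x = long ∷ x} (long B)  =
  trans (cong (2 +ℕ_) (Blocks-#1s B)) (lemma (shorts x) (longs x))
  where
  lemma : ∀ a b → 2 +ℕ (a +ℕ 2 *ℕ b) ≡ a +ℕ 2 *ℕ suc b
  lemma = ℕ-Solver.solve-∀

Blocks⇒IsPadovan : Blocks x w → IsPadovan (0F ∷ w)
Blocks⇒IsPadovan B = record
  { starts-with-0 = refl
  ; ends-with-0   = ends B
  ; no-00         = no00 B
  ; no-111        = no111 B
  }
  where
  ends : Blocks x w → last (0F ∷ w) ≡ just 0F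
  ends []        = refl
  ends (short B) = ends B
  ends (long B)  = ends B

  no00 : Blocks x w → ¬ ((0F ∷ 0F ∷ []) isSubwordOf (0F ∷ w))
  no00 []        (here (_ ∷ ()))
  no00 []        (there (here ()))
  no00 (short B) (here (_ ∷ () ∷ _))
  no00 (short B) (there (here (() ∷ _)))
  no00 (short B) (there (there s))         = no00 B s
  no00 (long B)  (here (_ ∷ () ∷ _))
  no00 (long B)  (there (here (() ∷ _)))
  no00 (long B)  (there (there (here (() ∷ _))))
  no00 (long B)  (there (there (there s))) = no00 B s

  no111 : Blocks x w → ¬ ((1F ∷ 1F ∷ 1F ∷ []) isSubwordOf (0F ∷ w))
  no111 []        (here (() ∷ _))
  no111 []        (there (here ()))
  no111 (short B) (here (() ∷ _))
  no111 (short B) (there (here (_ ∷ () ∷ _)))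
  no111 (short B) (there (there s))         = no111 B s
  no111 (long B)  (here (() ∷ _))
  no111 (long B)  (there (here (_ ∷ _ ∷ () ∷ _)))
  no111 (long B)  (there (there (here (_ ∷ () ∷ _))))
  no111 (long B)  (there (there (there s))) = no111 B s

-- After a 0 the next letter is 1, since 00 is excluded; then 0 or 10 must follow, since 111 is
-- excluded and the word ends with 0.
decode : IsPadovan w → ∃[ w′ ] ∃[ m ] ∃[ x ] (w ≡ 0F ∷ w′ × Blocks {m} x w′)
decode {w = []} record { starts-with-0 = () }
decode {w = 1F ∷ w} record { starts-with-0 = () }
decode {w = 0F ∷ w} pad = let m , x , B = go w ends-with-0 no-00 no-111 in w , m , x , refl , B
  where
  open IsPadovan pad
  -- The hypotheses concern `0F ∷ w` because the closing 0 of each block serves as the initial 0 for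
  -- the rest.
  go : ∀ w → last (0F ∷ w) ≡ just 0F → ¬ ((0F ∷ 0F ∷ []) isSubwordOf (0F ∷ w)) →
       ¬ ((1F ∷ 1F ∷ 1F ∷ []) isSubwordOf (0F ∷ w)) → ∃[ m ] ∃[ x ] Blocks {m} x w
  go []                l z o = 0 , [] , []
  go (0F ∷ w)          l z o = ⊥-elim (z (here (refl ∷ refl ∷ [])))
  go (1F ∷ [])         () z o
  go (1F ∷ 0F ∷ w)     l z o =
    let m , x , B = go w l (λ s → z (there (there s))) (λ s → o (there (there s)))
    in suc m , short ∷ x , short B
  go (1F ∷ 1F ∷ [])    () z o
  go (1F ∷ 1F ∷ 0F ∷ w) l z o =
    let m , x , B = go w l (λ s → z (there (there (there s)))) (λ s → o (there (there (there s))))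
    in suc m , long ∷ x , long B
  go (1F ∷ 1F ∷ 1F ∷ w) l z o = ⊥-elim (o (there (here (refl ∷ refl ∷ refl ∷ []))))

-- Exchanges of blocks as edges between words.

↝⇒⟶ : Blocks x w → Blocks y w′ → x ↝ y → w ⟶ w′
-- 10 110 reads 1·01·10 and 110 10 reads 1·10·10, hence the prefix 1.
↝⇒⟶ (short (long {w = w} B)) (long (short C)) here =
    1F ∷ [] , 1F ∷ 0F ∷ w , refl
  , cong (λ w → 1F ∷ 1F ∷ 0F ∷ 1F ∷ 0F ∷ w) (Blocks-word-unique C B)
↝⇒⟶ (short B) (short C) (there _ s) =
  let p , t , e , f = ↝⇒⟶ B C s
  in 1F ∷ 0F ∷ p , t , cong (λ w → 1F ∷ 0F ∷ w) e , cong (λ w → 1F ∷ 0F ∷ w) f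
↝⇒⟶ (long B) (long C) (there _ s) =
  let p , t , e , f = ↝⇒⟶ B C s
  in 1F ∷ 1F ∷ 0F ∷ p , t , cong (λ w → 1F ∷ 1F ∷ 0F ∷ w) e , cong (λ w → 1F ∷ 1F ∷ 0F ∷ w) f

0∷-⟶ : w ⟶ w′ → (0F ∷ w) ⟶ (0F ∷ w′)
0∷-⟶ (p , t , e , f) = 0F ∷ p , t , cong (0F ∷_) e , cong (0F ∷_) f

↭⇒Adjacent : Blocks x w → Blocks y w′ → x ↭ y → Adjacent (0F ∷ w) (0F ∷ w′)
↭⇒Adjacent B C (inj₁ s) = inj₁ (0∷-⟶ (↝⇒⟶ B C s))
↭⇒Adjacent B C (inj₂ s) = inj₂ (0∷-⟶ (↝⇒⟶ C B s))

⟶⇒↝ : {x y : Vec Block m} → Blocks x w → Blocks y w′ → (0F ∷ w) ⟶ (0F ∷ w′) → x ↝ y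
-- With an empty prefix the result would start with 1.
⟶⇒↝ _ _ ([]     , _ , _    , ())
⟶⇒↝ B C (0F ∷ p , t , refl , refl) = go p B C
  where
  go : ∀ p {m t} {x y : Vec Block m} →
       Blocks x (p ++ 0F ∷ 1F ∷ t) → Blocks y (p ++ 1F ∷ 0F ∷ t) → x ↝ y
  -- At the first differing block the source has 10 and the target 110. Then `t` starts at a block
  -- boundary of the target, which forces 110 next in the source and 10 in the target. Every prefix
  -- that is not listed breaks the block structure of one of the words.
  go (1F ∷ [])          (short (long B)) (long (short C)) with refl ← Blocks-unique B C = here
  go (1F ∷ 0F ∷ p)      (short B)        (short C)        = there short (go p B C)
  go (1F ∷ 1F ∷ 0F ∷ p) (long B)         (long C)         = there long (go p B C)

Adjacent⇒↭ : {x y : Vec Block m} → Blocks x w → Blocks y w′ → Adjacent (0F ∷ w) (0F ∷ w′) → x ↭ y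
Adjacent⇒↭ B C (inj₁ s) = inj₁ (⟶⇒↝ B C s)
Adjacent⇒↭ B C (inj₂ s) = inj₂ (⟶⇒↝ C B s)

-- Twice the number of ones minus the length behind the initial 0 is `b`; then `a` follows.
counts-unique : ∀ a b a′ b′ → 2 *ℕ a +ℕ 3 *ℕ b ≡ 2 *ℕ a′ +ℕ 3 *ℕ b′ →
                a +ℕ 2 *ℕ b ≡ a′ +ℕ 2 *ℕ b′ → a ≡ a′ × b ≡ b′
counts-unique a b a′ b′ e f = +-cancelʳ-≡ (2 *ℕ b) a a′ (trans f (cong (λ b → a′ +ℕ 2 *ℕ b) (sym b≡b′))) , b≡b′
  where
  open ≡-Reasoning
  lemma : ∀ a b → 2 *ℕ (a +ℕ 2 *ℕ b) ≡ (2 *ℕ a +ℕ 3 *ℕ b) +ℕ b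
  lemma = ℕ-Solver.solve-∀
  b≡b′ : b ≡ b′
  b≡b′ = +-cancelˡ-≡ (2 *ℕ a +ℕ 3 *ℕ b) b b′ (begin
    (2 *ℕ a +ℕ 3 *ℕ b) +ℕ b      ≡⟨ sym (lemma a b) ⟩
    2 *ℕ (a +ℕ 2 *ℕ b)           ≡⟨ cong (2 *ℕ_) f ⟩
    2 *ℕ (a′ +ℕ 2 *ℕ b′)         ≡⟨ lemma a′ b′ ⟩
    (2 *ℕ a′ +ℕ 3 *ℕ b′) +ℕ b′   ≡⟨ cong (_+ℕ b′) (sym e) ⟩
    (2 *ℕ a +ℕ 3 *ℕ b) +ℕ b′     ∎)

-- Distances and diameter for `a` short and `b` long blocks.

module Diameter (a b : ℕ) where
  open PadovanWord

  N K : ℕ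
  N = suc (2 *ℕ a +ℕ 3 *ℕ b)
  K = a +ℕ 2 *ℕ b

  -- Fixing the length `a +ℕ b` puts the block sequences of all vertices into one type, where `dist`
  -- and `Path` can compare them.
  record Decoding (u : PadovanWord N K) : Set where
    field
      {tail}   : Word
      blocks   : Vec Block (a +ℕ b)
      word≡    : word u ≡ 0F ∷ tail
      isBlocks : Blocks blocks tail
      shorts≡a : shorts blocks ≡ a
      longs≡b  : longs blocks ≡ b
  open Decoding

  decoding : ∀ u → Decoding u
  decoding record { isPadovan = pad ; length≡n = ln ; #1s≡k = lk } with decode pad
  ... | w , m , x , refl , B
    with e , f ← counts-unique (shorts x) (longs x) a b
                         (trans (sym (Blocks-length B)) (suc-injective ln))
                         (trans (sym (Blocks-#1s B)) lk)
    -- Identifies the decoded number of blocks with `a +ℕ b`.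
    with refl ← trans (sym (shorts+longs x)) (cong₂ _+ℕ_ e f)
    = record { blocks = x ; word≡ = refl ; isBlocks = B ; shorts≡a = e ; longs≡b = f }

  vertex : (x : Vec Block (a +ℕ b)) → shorts x ≡ a → longs x ≡ b → ∃[ u ] Decoding u
  vertex x e f =
    let w , B = encode x
    in record { word = 0F ∷ w ; isPadovan = Blocks⇒IsPadovan B
              ; length≡n = cong suc (trans (Blocks-length B) (cong₂ (λ a b → 2 *ℕ a +ℕ 3 *ℕ b) e f))
              ; #1s≡k = trans (Blocks-#1s B) (cong₂ (λ a b → a +ℕ 2 *ℕ b) e f) }
     , record { blocks = x ; word≡ = refl ; isBlocks = B ; shorts≡a = e ; longs≡b = f }

  private variable
    u v : PadovanWord N K

  Path⇒Walk : (du : Decoding u) (dv : Decoding v) →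
              Path (blocks du) (blocks dv) i → Walk (Φ N K) u v i
  Path⇒Walk du dv = go du (word≡ dv) (isBlocks dv)
    where
    go : ∀ {y} (du : Decoding u) → word v ≡ 0F ∷ w → Blocks y w →
         Path (blocks du) y i → Walk (Φ N K) u v i
    go du e C nil =
      nil (trans (word≡ du) (trans (cong (0F ∷_) (Blocks-word-unique (isBlocks du) C)) (sym e)))
    go du e C (cons {y = z} s P) =
      -- An exchange preserves both counts, so the intermediate sequence is again a vertex of the
      -- same graph.
      let f , g = ↭⇒≈ₘ s
          _ , dz = vertex z (trans (sym f) (shorts≡a du)) (trans (sym g) (longs≡b du))
      in cons (subst (λ w → Adjacent w _) (sym (word≡ du)) (↭⇒Adjacent (isBlocks du) (isBlocks dz) s))
              (go dz e C P)

  -- The lower bound: each edge is an exchange and lowers `dist` by at most one, while `dist`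
  -- vanishes at the end of the walk.
  Walk⇒dist≤ : (du : Decoding u) (dv : Decoding v) →
               Walk (Φ N K) u v i → dist 0 0 (blocks du) (blocks dv) ≤ i
  Walk⇒dist≤ du dv (nil e)
    with refl ← trans (sym (word≡ du)) (trans e (word≡ dv))
    = ≤-reflexive (trans (cong (λ x → dist 0 0 x (blocks dv)) (Blocks-unique (isBlocks du) (isBlocks dv)))
                         (dist-refl 0 (blocks dv)))
  Walk⇒dist≤ du dv (cons {v = z} s W) =
    let dz = decoding z
        t  = Adjacent⇒↭ (isBlocks du) (isBlocks dz) (subst₂ Adjacent (word≡ du) (word≡ dz) s)
    in ≤-trans (dist-↭ t (blocks dv)) (s≤s (Walk⇒dist≤ dz dv W))

  geodesicBetween : (du : Decoding u) (dv : Decoding v) → Geodesic (blocks du) (blocks dv)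
  geodesicBetween du dv = geodesic _ _
    (trans (shorts≡a du) (sym (shorts≡a dv)) , trans (longs≡b du) (sym (longs≡b dv)))

  isDistance : (du : Decoding u) (dv : Decoding v) →
               IsDistance (Φ N K) u v (dist 0 0 (blocks du) (blocks dv))
  isDistance du dv = Path⇒Walk du dv (proj₁ (geodesicBetween du dv)) , λ _ → Walk⇒dist≤ du dv

  isDiameter : IsDiameter (Φ N K) (a *ℕ b)
  isDiameter = bounded , attained
    where
    bounded : ∀ u v → ∃[ d ] (IsDistance (Φ N K) u v d × d ≤ a *ℕ b)
    bounded u v =
      let du = decoding u
          dv = decoding v
      in _ , isDistance du dv
       , subst₂ (λ a b → dist 0 0 (blocks du) (blocks dv) ≤ a *ℕ b) (shorts≡a du) (longs≡b du) (proj₂ (geodesicBetween du dv))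
    attained : ∃[ u ] ∃[ v ] IsDistance (Φ N K) u v (a *ℕ b)
    attained with farthest a b
    ... | m , x , _ , y , _ , e , f , (g , h) , d
      with refl ← trans (sym (shorts+longs x)) (cong₂ _+ℕ_ e f) =
      let u , du = vertex x e f
          v , dv = vertex y (trans (sym g) e) (trans (sym h) f)
      in u , v , subst (IsDistance (Φ N K) u v) d (isDistance du dv)

-- From `n` and `k` to the numbers of blocks.

block-counts : ∀ n k → 1 ≤ n → n / 2 ≤ k → k ≤ (2 *ℕ n ∸ 2) / 3 →
  ∃[ a ] ∃[ b ] (n ≡ suc (2 *ℕ a +ℕ 3 *ℕ b) × k ≡ a +ℕ 2 *ℕ b)
block-counts n k 1≤n l r = a , b
  -- Two times `ea` plus three times `eb`, with the surplus 3n + 6k + 3 cancelled; below, `ea` plus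
  -- two times `eb` gives `k`.
  , +-cancelʳ-≡ (3 *ℕ n +ℕ (6 *ℕ k +ℕ 3)) n (suc (2 *ℕ a +ℕ 3 *ℕ b)) (begin
      n +ℕ (3 *ℕ n +ℕ (6 *ℕ k +ℕ 3))                               ≡⟨ lemma₁ n k ⟩
      2 *ℕ (2 *ℕ n) +ℕ 3 *ℕ suc (k *ℕ 2)                           ≡⟨ cong₂ (λ s t → 2 *ℕ s +ℕ 3 *ℕ t) (sym ea) (sym eb) ⟩
      2 *ℕ (a +ℕ k *ℕ 3 +ℕ 2) +ℕ 3 *ℕ (b +ℕ n)                     ≡⟨ lemma₂ a b n k ⟩
      suc (2 *ℕ a +ℕ 3 *ℕ b) +ℕ (3 *ℕ n +ℕ (6 *ℕ k +ℕ 3))          ∎)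
  , +-cancelʳ-≡ (2 *ℕ n +ℕ (3 *ℕ k +ℕ 2)) k (a +ℕ 2 *ℕ b) (begin
      k +ℕ (2 *ℕ n +ℕ (3 *ℕ k +ℕ 2))                               ≡⟨ lemma₃ n k ⟩
      2 *ℕ n +ℕ 2 *ℕ suc (k *ℕ 2)                                  ≡⟨ cong₂ (λ s t → s +ℕ 2 *ℕ t) (sym ea) (sym eb) ⟩
      (a +ℕ k *ℕ 3 +ℕ 2) +ℕ 2 *ℕ (b +ℕ n)                          ≡⟨ lemma₄ a b n k ⟩
      (a +ℕ 2 *ℕ b) +ℕ (2 *ℕ n +ℕ (3 *ℕ k +ℕ 2))                   ∎)
  where
  open ≡-Reasoning
  a b : ℕ
  -- The solution of n = 1 + 2a + 3b and k = a + 2b. The bounds on `n` and `k` ensure that no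
  -- subtraction is truncated.
  a = 2 *ℕ n ∸ 2 ∸ k *ℕ 3
  b = suc (k *ℕ 2) ∸ n
  n≤ : n ≤ suc (k *ℕ 2)
  -- The remainder of `n` modulo 2 is at most 1.
  n≤ = ≤-trans (≤-reflexive (m≡m%n+[m/n]*n n 2)) (+-mono-≤ (≤-pred (m%n<n n 2)) (*-monoˡ-≤ 2 l))
  eb : b +ℕ n ≡ suc (k *ℕ 2)
  eb = m∸n+n≡m n≤
  ea : a +ℕ k *ℕ 3 +ℕ 2 ≡ 2 *ℕ n
  ea = trans (cong (_+ℕ 2) (m∸n+n≡m (≤-trans (*-monoˡ-≤ 3 r) (m/n*n≤m _ 3))))
             (m∸n+n≡m (*-monoʳ-≤ 2 1≤n))
  lemma₁ : ∀ n k → n +ℕ (3 *ℕ n +ℕ (6 *ℕ k +ℕ 3)) ≡ 2 *ℕ (2 *ℕ n) +ℕ 3 *ℕ suc (k *ℕ 2)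
  lemma₁ = ℕ-Solver.solve-∀
  lemma₂ : ∀ a b n k → 2 *ℕ (a +ℕ k *ℕ 3 +ℕ 2) +ℕ 3 *ℕ (b +ℕ n)
                     ≡ suc (2 *ℕ a +ℕ 3 *ℕ b) +ℕ (3 *ℕ n +ℕ (6 *ℕ k +ℕ 3))
  lemma₂ = ℕ-Solver.solve-∀
  lemma₃ : ∀ n k → k +ℕ (2 *ℕ n +ℕ (3 *ℕ k +ℕ 2)) ≡ 2 *ℕ n +ℕ 2 *ℕ suc (k *ℕ 2)
  lemma₃ = ℕ-Solver.solve-∀
  lemma₄ : ∀ a b n k → (a +ℕ k *ℕ 3 +ℕ 2) +ℕ 2 *ℕ (b +ℕ n)
                     ≡ (a +ℕ 2 *ℕ b) +ℕ (2 *ℕ n +ℕ (3 *ℕ k +ℕ 2))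
  lemma₄ = ℕ-Solver.solve-∀

-- With these `n` and `k` the two factors simplify to `a` and `b`; once the casts are pushed inwards
-- this is a polynomial identity over the integers.
block-counts-product : ∀ a b → let n = suc (2 *ℕ a +ℕ 3 *ℕ b) ; k = a +ℕ 2 *ℕ b in
  + (a *ℕ b) ≡ (+ 2 * + n - + 3 * + k - + 2) * (+ 2 * + k - + n + + 1)
block-counts-product a b = begin
  + (a *ℕ b)                                                  ≡⟨ pos-* a b ⟩
  + a * + b                                                   ≡⟨ identity (+ a) (+ b) ⟩
  rhs (+ 1 + (+ 2 * + a + + 3 * + b)) (+ a + + 2 * + b)       ≡⟨ cong₂ rhs (sym n≡) (sym k≡) ⟩
  rhs (+ suc (2 *ℕ a +ℕ 3 *ℕ b)) (+ (a +ℕ 2 *ℕ b))            ∎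
  where
  open ≡-Reasoning
  rhs : ℤ → ℤ → ℤ
  rhs n k = (+ 2 * n - + 3 * k - + 2) * (+ 2 * k - n + + 1)
  identity : ∀ a b → a * b ≡ (+ 2 * (+ 1 + (+ 2 * a + + 3 * b)) - + 3 * (a + + 2 * b) - + 2)
                           * (+ 2 * (a + + 2 * b) - (+ 1 + (+ 2 * a + + 3 * b)) + + 1)
  identity = ℤ-Solver.solve-∀
  n≡ : + suc (2 *ℕ a +ℕ 3 *ℕ b) ≡ + 1 + (+ 2 * + a + + 3 * + b)
  n≡ = trans (pos-+ 1 (2 *ℕ a +ℕ 3 *ℕ b))
      (cong (_+_ (+ 1)) (trans (pos-+ (2 *ℕ a) (3 *ℕ b)) (cong₂ _+_ (pos-* 2 a) (pos-* 3 b))))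
  k≡ : + (a +ℕ 2 *ℕ b) ≡ + a + + 2 * + b
  k≡ = trans (pos-+ a (2 *ℕ b)) (cong (_+_ (+ a)) (pos-* 2 b))

proposition4p3 : (n k : ℕ) → 1 ≤ n → n / 2 ≤ k → k ≤ (2 *ℕ n ∸ 2) / 3 →
    ∃[ D ] (IsDiameter (Φ n k) D ×
    + D ≡ (+ 2 * + n - + 3 * + k - + 2) * (+ 2 * + k - + n + + 1))
proposition4p3 n k 1≤n l r with block-counts n k 1≤n l r
-- The equations turn `n` and `k` into the `N` and `K` of `Diameter a b`.
... | a , b , refl , refl = a *ℕ b , Diameter.isDiameter a b , block-counts-product a b
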